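{- There exists a planar graph $G$ with $\operatorname{diam}(G)\ge 6$.
   Context: Graphs are finite and simple. For an oriented graph $\overrightarrow{G}$ and $X\subseteq V(\overrightarrow{G})$, the inversion of $X$ reverses every arc having both endpoints in $X$ (and no other arc). For a (labeled) graph $G$, the inversion distance between two orientations of $G$ is the minimum number of inversions transforming one into the other (equality as labeled oriented graphs), and the inversion diameter $\operatorname{diam}(G)$ is the maximum inversion distance over all pairs of orientations of $G$. -}

module Defs where

open import Data.Bool using (Bool; true; false; T; not; if_then_else_; _∧_)
open import Data.Bool.Properties using (∧-comm)
open import Data.Fin using (Fin; zero; suc; inject₁; fromℕ; toℕ; _<_)
open import Data.Fin.Subset using (Subset)
open import Data.List using (List; length; foldl)
open import Data.Nat using (ℕ; suc; _≤_)
open import Data.Product using (∃₂; ∃-syntax; _×_; _,_; proj₁; proj₂)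
open import Data.Rational using (ℚ; 0ℚ; 1ℚ; _+_; _*_; _-_) renaming (_≤_ to _≤ℚ_)
open import Data.Vec using (lookup)
open import Relation.Nullary using (¬_)
open import Relation.Binary.PropositionalEquality using (_≡_; _≢_; subst)

record Graph : Set where
  field
    order     : ℕ
    adj       : Fin order → Fin order → Bool
    symmetric : ∀ u v → adj u v ≡ adj v u
    loopless  : ∀ v → adj v v ≡ false

  Vertex : Set
  Vertex = Fin order

  Adjacent : Vertex → Vertex → Set
  Adjacent u v = T (adj u v)

-- An undirected edge is represented once, by its ends in increasing order.
record Edge (G : Graph) : Set where
  open Graph G
  field
    left right : Vertex
    left<right : left < right
    adjacent   : Adjacent left right

  ends : Vertex × Vertex
  ends = left , right

record Orientation (G : Graph) : Set where
  open Graph G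
  field
    arc      : Vertex → Vertex → Bool
    arc⇒edge : ∀ u v → T (arc u v) → Adjacent u v
    -- exactly one of the two arcs on each edge
    oriented : ∀ u v → Adjacent u v → arc v u ≡ not (arc u v)

module _ {G : Graph} where
  open Graph G
  open Orientation

  infix 4 _≈_
  _≈_ : Orientation G → Orientation G → Set
  D ≈ D′ = ∀ u v → arc D u v ≡ arc D′ u v

  both-in : Subset order → Vertex → Vertex → Bool
  both-in X u v = lookup X u ∧ lookup X v

  invert : Subset order → Orientation G → Orientation G
  arc (invert X D) u v = if both-in X u v then arc D v u else arc D u v
  arc⇒edge (invert X D) u v a with both-in X u v
  ... | true  = subst T (symmetric v u) (arc⇒edge D v u a)
  ... | false = arc⇒edge D u v a
  oriented (invert X D) u v e
    rewrite ∧-comm (lookup X v) (lookup X u) with both-in X u v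
  ... | true  = oriented D v u (subst T (symmetric u v) e)
  ... | false = oriented D u v e

  invertAll : List (Subset order) → Orientation G → Orientation G
  invertAll Xs D = foldl (λ D′ X → invert X D′) D Xs

IsMinimum IsMaximum : (ℕ → Set) → ℕ → Set
IsMinimum P m = P m × (∀ k → P k → m ≤ k)
IsMaximum P m = P m × (∀ k → P k → k ≤ m)

IsInversionDistance : {G : Graph} → Orientation G → Orientation G → ℕ → Set
IsInversionDistance D D′ =
  IsMinimum (λ k → ∃[ Xs ] (length Xs ≡ k × invertAll Xs D ≈ D′))

IsInversionDiameter : Graph → ℕ → Set
IsInversionDiameter G =
  IsMaximum (λ k → ∃₂ λ (D D′ : Orientation G) → IsInversionDistance D D′ k)

-- Plane drawings have polygonal arcs as edges. Working in ℚ² instead of ℝ² does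
-- not change which finite graphs are planar: the corners of a polygonal drawing
-- can be perturbed to rational points, and two segments with rational ends that
-- meet in ℝ² also meet in a rational point (and if they share a second point,
-- they share a second rational one).
Point : Set
Point = ℚ × ℚ

OnSegment : Point → Point → Point → Set
OnSegment a b p = ∃[ t ]
  ( 0ℚ ≤ℚ t × t ≤ℚ 1ℚ
  × proj₁ p ≡ (1ℚ - t) * proj₁ a + t * proj₁ b
  × proj₂ p ≡ (1ℚ - t) * proj₂ a + t * proj₂ b )

-- A union of finitely many segments, laid end to end without self-intersection.
record PolygonalArc (a b : Point) : Set where
  field
    bends  : ℕ
    corner : Fin (suc (suc bends)) → Point
    start  : corner zero ≡ a
    end    : corner (fromℕ (suc bends)) ≡ b

  OnPiece : Fin (suc bends) → Point → Set
  OnPiece i = OnSegment (corner (inject₁ i)) (corner (suc i))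

  field
    nondegenerate : ∀ i → corner (inject₁ i) ≢ corner (suc i)
    -- two pieces meet only if consecutive, and then only in their common corner
    simple : ∀ i j p → i < j → OnPiece i p → OnPiece j p →
             toℕ j ≡ suc (toℕ i) × p ≡ corner (suc i)

  OnArc : Point → Set
  OnArc p = ∃[ i ] OnPiece i p

  Interior : Point → Set
  Interior p = OnArc p × p ≢ a × p ≢ b

record PlaneDrawing (G : Graph) : Set where
  open Graph G
  open Edge
  open PolygonalArc
  field
    place     : Vertex → Point
    injective : ∀ u v → place u ≡ place v → u ≡ v
    curve     : (e : Edge G) → PolygonalArc (place (left e)) (place (right e))
    avoids-vertices : ∀ e w → ¬ Interior (curve e) (place w)
    avoids-edges    : ∀ e f → ends e ≢ ends f →
                      ∀ p → Interior (curve e) p → ¬ OnArc (curve f) p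

Planar : Graph → Set
Planar = PlaneDrawing

{-# OPTIONS --safe #-}
-- Orient the edges of G from smaller to larger vertices. At most k inversions turn this
-- orientation into another one exactly when the edges uv to be reversed are given by the
-- scalar products f u · f v of a map f from the vertices to F₂ᵏ (the i-th coordinate of f u
-- says whether u lies in the i-th inverted set). So it is enough to label the edges of a
-- planar graph by 0 and 1 such that no map to F₂⁵ has these scalar products. The graph is a
-- stacked triangulation: a new vertex is placed in a triangle abc and the three triangles so
-- created are treated recursively. A triple of vectors for a, b, c cannot be extended to the
-- interior if every choice for the new vertex is ruled out in one of the three smaller
-- triangles, so the bad triples are computed bottom-up.
module Submission where

open import Data.Bool using (Bool; true; false; T; not; if_then_else_; _∧_; _∨_; _xor_)
open import Data.Bool.ListAction using (any; all)
open import Data.Bool.Properties as Bool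
  using (T-≡; T-∨; ∨-comm; not-injective; not-involutive; ¬-not; xor-assoc; xor-identityʳ)
open import Data.Fin using (Fin; zero; suc; _≟_; _<?_; _<_; combine; remQuot; #_)
open import Data.Fin.Properties as Fin using (remQuot-combine; <-cmp; <-irrefl; <-asym)
open import Data.Fin.Subset using (Subset; _∪_; ⁅_⁆)
open import Data.Fin.Subset.Properties using (anySubset?; x∈p∪q⁻; x∈p∪q⁺; x∈⁅x⁆; x∈⁅y⁆⇒x≡y)
open import Data.Integer as ℤ using (ℤ; 0ℤ; +_)
import Data.Integer.Properties as ℤ
import Data.Integer.Solver as ℤSolver
open import Data.List using (List; []; _∷_; _++_; length; map; filter; cartesianProduct; allFin)
open import Data.List.Extrema.Nat using (argmax; f[xs]≤f[argmax])
open import Data.List.Membership.Propositional using (_∈_; find)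
open import Data.List.Membership.Propositional.Properties
  using (∈-++⁺ˡ; ∈-++⁺ʳ; ∈-map⁺; ∈-filter⁺; ∈-cartesianProduct⁺; ∈-allFin)
open import Data.List.Properties using (foldl-++)
open import Data.List.Relation.Unary.All as All using (All; []; _∷_)
open import Data.List.Relation.Unary.All.Properties using (all⁺; ++⁻ˡ; ++⁻ʳ)
open import Data.List.Relation.Unary.Any as Any using (Any; here; there)
open import Data.List.Relation.Unary.Any.Properties using (any⁺; any⁻)
open import Data.Nat using (ℕ; zero; suc; _*_; _≤_; _≥_; z≤n; s≤s; _≤?_)
open import Data.Nat.Properties using (≤-antisym; ≤-trans; ≤-reflexive; <⇒≯; ≰⇒>)
open import Data.Product as Product using (∃; ∃-syntax; _×_; _,_; proj₁; proj₂; uncurry)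
open import Data.Product.Properties using (≡-dec)
open import Data.Rational as ℚ using (ℚ; 0ℚ; 1ℚ; positive; nonNegative)
open import Data.Rational.Literals using (fromℤ)
import Data.Rational.Properties as ℚ
import Data.Rational.Solver as ℚSolver
import Data.Rational.Unnormalised as ℚᵘ
import Data.Rational.Unnormalised.Properties as ℚᵘ
open import Data.Sum as Sum using (_⊎_; inj₁; inj₂)
open import Data.Vec as Vec using (Vec; []; _∷_; lookup; tabulate; replicate; padRight)
open import Data.Vec.Properties using ([]=⇒lookup; lookup⇒[]=; lookup∘tabulate)
open import Function using (Equivalence; _∘_)
open import Relation.Binary.Definitions using (tri<; tri≈; tri>)
open import Relation.Binary.PropositionalEquality
  using (_≡_; _≢_; refl; sym; trans; cong; cong₂; subst; subst₂; module ≡-Reasoning)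
open import Relation.Nullary using (¬_; Dec; yes; no; does; contradiction)
open import Relation.Nullary.Decidable
  using (map′; dec-true; dec-false; _×-dec_; _⊎-dec_; _→-dec_; ¬?)
open import Defs

-- Existence of the inversion diameter

least : {P : ℕ → Set} → (∀ k → Dec (P k)) → ∀ k → P k → ∃ (IsMinimum P)
least P? zero    p = zero , p , λ _ _ → z≤n
least P? (suc k) p with P? zero
... | yes p₀ = zero , p₀ , λ _ _ → z≤n
... | no ¬p₀ with least (P? ∘ suc) k p
...   | m , pₘ , m≤ = suc m , pₘ ,
        λ { zero p₀ → contradiction p₀ ¬p₀ ; (suc j) pⱼ → s≤s (m≤ j pⱼ) }

IsMinimum-unique : ∀ {P : ℕ → Set} {k m} → IsMinimum P k → IsMinimum P m → k ≡ m
IsMinimum-unique (pₖ , k≤) (pₘ , m≤) = ≤-antisym (k≤ _ pₘ) (m≤ _ pₖ)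

vectors : ∀ n → List (Vec Bool n)
vectors zero    = [] ∷ []
vectors (suc n) = map (false ∷_) (vectors n) ++ map (true ∷_) (vectors n)

∈-vectors : ∀ {n} (v : Vec Bool n) → v ∈ vectors n
∈-vectors []          = here refl
∈-vectors (false ∷ v) = ∈-++⁺ˡ (∈-map⁺ (false ∷_) (∈-vectors v))
∈-vectors (true ∷ v)  = ∈-++⁺ʳ _ (∈-map⁺ (true ∷_) (∈-vectors v))

∈-pair : ∀ {n} (u v w : Fin n) → lookup (⁅ u ⁆ ∪ ⁅ v ⁆) w ≡ true → w ≡ u ⊎ w ≡ v
∈-pair u v w eq = Sum.map (x∈⁅y⁆⇒x≡y u) (x∈⁅y⁆⇒x≡y v)
                          (x∈p∪q⁻ ⁅ u ⁆ ⁅ v ⁆ (lookup⇒[]= w _ eq))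

module _ {G : Graph} where
  open Graph G
  open Orientation

  ≈-sym : {D E : Orientation G} → D ≈ E → E ≈ D
  ≈-sym p u v = sym (p u v)

  ≈-trans : {D E F : Orientation G} → D ≈ E → E ≈ F → D ≈ F
  ≈-trans p q u v = trans (p u v) (q u v)

  arc-nonadjacent : ∀ (D : Orientation G) u v → adj u v ≡ false → arc D u v ≡ false
  arc-nonadjacent D u v uv∉E with arc D u v in eq
  ... | false = refl
  ... | true  with () ← subst T uv∉E (arc⇒edge D u v (subst T (sym eq) _))

  arc-reverse : ∀ (D E : Orientation G) u v →
                arc D u v ≡ arc E u v → arc D v u ≡ arc E v u
  arc-reverse D E u v eq with adj u v in uv
  ... | true  = trans (oriented D u v uv∈E) (trans (cong not eq) (sym (oriented E u v uv∈E)))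
    where uv∈E = subst T (sym uv) _
  ... | false = trans (arc-nonadjacent D v u vu) (sym (arc-nonadjacent E v u vu))
    where vu = trans (symmetric v u) uv

  arc-reverse-≢ : ∀ (D E : Orientation G) u v →
                  arc D u v ≢ arc E u v → arc D v u ≡ arc E u v
  arc-reverse-≢ D E u v ne with adj u v in uv
  ... | true  = trans (oriented D u v (subst T (sym uv) _)) (sym (¬-not (ne ∘ sym)))
  ... | false = contradiction
    (trans (arc-nonadjacent D u v uv) (sym (arc-nonadjacent E u v uv))) ne

  invert-cong : ∀ {D E : Orientation G} X → D ≈ E → invert X D ≈ invert X E
  invert-cong X p u v with both-in {G} X u v
  ... | true  = p v u
  ... | false = p u v

  invertAll-cong : ∀ {D E : Orientation G} Xs → D ≈ E → invertAll Xs D ≈ invertAll Xs E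
  invertAll-cong []       p = p
  invertAll-cong {D} {E} (X ∷ Xs) p =
    invertAll-cong {invert X D} {invert X E} Xs (invert-cong {D} {E} X p)

  Reaches : Orientation G → Orientation G → ℕ → Set
  Reaches D E k = ∃[ Xs ] (length Xs ≡ k × invertAll Xs D ≈ E)

  _≈?_ : (D E : Orientation G) → Dec (D ≈ E)
  D ≈? E = Fin.all? λ u → Fin.all? λ v → arc D u v Bool.≟ arc E u v

  -- Each step has only finitely many subsets to try. This decision is what lets `least` find the
  -- minimum.
  reaches? : ∀ D E k → Dec (Reaches D E k)
  reaches? D E zero = map′ (λ p → [] , refl , p) (λ { ([] , _ , p) → p }) (D ≈? E)
  reaches? D E (suc k) = map′
    (λ { (X , Xs , len , p) → X ∷ Xs , cong suc len , p })
    (λ { (X ∷ Xs , refl , p) → X , Xs , refl , p })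
    (anySubset? λ X → reaches? (invert X D) E k)

  reaches-cong : ∀ {D D′ E E′} k → D ≈ D′ → E ≈ E′ → Reaches D E k → Reaches D′ E′ k
  reaches-cong {D} {D′} {E} {E′} k p q (Xs , len , r) = Xs , len ,
    ≈-trans {invertAll Xs D′} {E} {E′}
      (≈-trans {invertAll Xs D′} {invertAll Xs D} {E}
        (invertAll-cong {D′} {D} Xs (≈-sym {D} {D′} p)) r) q

  both-in-pair : ∀ u v → both-in {G} (⁅ u ⁆ ∪ ⁅ v ⁆) u v ≡ true
  both-in-pair u v = cong₂ _∧_ ([]=⇒lookup (x∈p∪q⁺ (inj₁ (x∈⁅x⁆ u))))
                               ([]=⇒lookup (x∈p∪q⁺ {p = ⁅ u ⁆} (inj₂ (x∈⁅x⁆ v))))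

  -- Inverting the set of two vertices can change only the edge between them, so one wrong edge is
  -- corrected and every other pair is left alone.
  invert-pair : ∀ (D E : Orientation G) u v x y → arc D u v ≢ arc E u v →
                (x , y) ≡ (u , v) ⊎ arc D x y ≡ arc E x y →
                arc (invert (⁅ u ⁆ ∪ ⁅ v ⁆) D) x y ≡ arc E x y
  invert-pair D E u v x y ne (inj₁ refl) rewrite both-in-pair u v = arc-reverse-≢ D E u v ne
  invert-pair D E u v x y ne (inj₂ eq)
    with lookup (⁅ u ⁆ ∪ ⁅ v ⁆) x in xin | lookup (⁅ u ⁆ ∪ ⁅ v ⁆) y in yin
  ... | false | _     = eq
  ... | true  | false = eq
  ... | true  | true with ∈-pair u v x xin | ∈-pair u v y yin
  ...   | inj₁ refl | inj₁ refl = eq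
  ...   | inj₂ refl | inj₂ refl = eq
  ...   | inj₁ refl | inj₂ refl = contradiction eq ne
  ...   | inj₂ refl | inj₁ refl = contradiction (arc-reverse D E v u eq) ne

  -- Wrong pairs are corrected one at a time by `invert-pair`. Applied to all pairs of vertices,
  -- this shows that the distance is finite.
  agree-on : ∀ (ps : List (Vertex × Vertex)) (D E : Orientation G) →
             ∃[ Xs ] (∀ {u v} → (u , v) ∈ ps → arc (invertAll Xs D) u v ≡ arc E u v)
  agree-on []             D E = [] , λ ()
  agree-on ((u , v) ∷ ps) D E with agree-on ps D E
  ... | Xs , agree with arc (invertAll Xs D) u v Bool.≟ arc E u v
  ...   | yes eq = Xs , λ { (here refl) → eq ; (there p) → agree p }
  ...   | no  ne = Xs ++ P ∷ [] , λ {x} {y} p →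
          trans (cong (λ F → arc F x y) (foldl-++ (λ F X → invert X F) D Xs (P ∷ [])))
                (invert-pair (invertAll Xs D) E u v x y ne (fixed p))
    where
    P = ⁅ u ⁆ ∪ ⁅ v ⁆
    fixed : ∀ {x y} → (x , y) ∈ (u , v) ∷ ps →
            (x , y) ≡ (u , v) ⊎ arc (invertAll Xs D) x y ≡ arc E x y
    fixed (here eq) = inj₁ eq
    fixed (there p) = inj₂ (agree p)

  distance : ∀ D E → ∃ (IsInversionDistance D E)
  distance D E with agree-on (cartesianProduct (allFin order) (allFin order)) D E
  ... | Xs , agree = least (reaches? D E) (length Xs)
          (Xs , refl , λ u v → agree (∈-cartesianProduct⁺ (∈-allFin u) (∈-allFin v)))

  dist : Orientation G → Orientation G → ℕ
  dist D E = proj₁ (distance D E)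

  IsInversionDistance-cong : ∀ {D D′ E E′ k} → D ≈ D′ → E ≈ E′ →
    IsInversionDistance D E k → IsInversionDistance D′ E′ k
  IsInversionDistance-cong {D} {D′} {E} {E′} {k} p q (r , k≤) =
    reaches-cong {D} {D′} {E} {E′} k p q r ,
    λ j s → k≤ j (reaches-cong {D′} {D} {E′} {E} j (≈-sym {D} {D′} p) (≈-sym {E} {E′} q) s)

  -- Since `s` is consulted at increasing pairs only, every Boolean function yields an orientation,
  -- be it a code to enumerate or an edge labelling.
  orient : (Vertex → Vertex → Bool) → Orientation G
  arc (orient s) u v = adj u v ∧ (if does (u <? v) then s u v else not (s v u))
  arc⇒edge (orient s) u v a with adj u v
  ... | true = _
  oriented (orient s) u v uv∈E rewrite symmetric v u with adj u v in uv
  ... | true with <-cmp u v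
  ...   | tri< u<v _ _ rewrite dec-true (u <? v) u<v | dec-false (v <? u) (<⇒≯ u<v) = refl
  ...   | tri≈ _ refl _ with () ← trans (sym uv) (loopless u)
  ...   | tri> _ _ v<u rewrite dec-true (v <? u) v<u | dec-false (u <? v) (<⇒≯ v<u) =
          sym (not-involutive (s v u))

  orient-cong : ∀ {s t} → (∀ u v → s u v ≡ t u v) → orient s ≈ orient t
  orient-cong eq u v rewrite eq u v | eq v u = refl

  orient-arc : ∀ D → orient (arc D) ≈ D
  orient-arc D u v with adj u v in uv
  ... | false = sym (arc-nonadjacent D u v uv)
  ... | true with does (u <? v)
  ...   | true  = refl
  ...   | false = sym (oriented D v u (subst T (trans (sym uv) (symmetric u v)) _))

  -- A maximum over all orientations calls for a finite list, while an orientation is a function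
  -- with proofs. The bit vectors of length `order * order` form such a list and reach every
  -- orientation up to `≈`.
  decode : Vec Bool (order * order) → Orientation G
  decode bs = orient λ u v → lookup bs (combine u v)

  encode : Orientation G → Vec Bool (order * order)
  encode D = tabulate (uncurry (arc D) ∘ remQuot order)

  decode-encode : ∀ D → decode (encode D) ≈ D
  decode-encode D = ≈-trans {decode (encode D)} {orient (arc D)} {D}
    (orient-cong λ u v → trans (lookup∘tabulate _ (combine u v))
                               (cong (uncurry (arc D)) (remQuot-combine u v)))
    (orient-arc D)

-- The distance is maximised over all pairs of codes. Any pair D, E has the same distance as its
-- decoded codes, because distances respect `≈` and are unique.
inversionDiameter : ∀ G → ∃ (IsInversionDiameter G)
inversionDiameter G = size far , (decode (proj₁ far) , decode (proj₂ far) , isDist far) ,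
  λ { k (D , E , isDₖ) → ≤-trans
    (≤-reflexive (IsMinimum-unique {P = Reaches {G} (decode (encode D)) (decode (encode E))}
      (IsInversionDistance-cong {G} {D} {decode (encode D)} {E} {decode (encode E)} {k}
        (≈-sym {G} {decode (encode D)} {D} (decode-encode D))
        (≈-sym {G} {decode (encode E)} {E} (decode-encode E)) isDₖ)
      (isDist (encode D , encode E))))
    (All.lookup (f[xs]≤f[argmax] {f = size} start pairs)
      (∈-cartesianProduct⁺ (∈-vectors (encode D)) (∈-vectors (encode E)))) }
  where
  open Graph G using (order)
  Code  = Vec Bool (order * order)
  size : Code × Code → ℕ
  size (x , y) = dist {G} (decode x) (decode y)
  isDist : ∀ p → IsInversionDistance {G} (decode (proj₁ p)) (decode (proj₂ p)) (size p)
  isDist (x , y) = proj₂ (distance {G} (decode x) (decode y))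
  pairs = cartesianProduct (vectors (order * order)) (vectors (order * order))
  -- The default value for `argmax`. It is itself a pair of codes, so the maximum is attained by
  -- orientations even when the default is returned.
  start : Code × Code
  start = replicate _ false , replicate _ false
  far = argmax size start pairs

-- Inversions and scalar products over F₂

infix 7 _·_
_·_ : ∀ {n} → Vec Bool n → Vec Bool n → Bool
[]      · []      = false
(x ∷ v) · (y ∷ w) = (x ∧ y) xor (v · w)

replicate-· : ∀ n → replicate n false · replicate n false ≡ false
replicate-· zero    = refl
replicate-· (suc n) = replicate-· n

-- Padding with zeros lets any sequence of at most n inversions be treated as giving vectors of
-- length exactly n.
padRight-· : ∀ {m n} (m≤n : m ≤ n) (v w : Vec Bool m) →
             padRight m≤n false v · padRight m≤n false w ≡ v · w
padRight-· {n = n} z≤n       []      []      = replicate-· n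
padRight-· (s≤s m≤n) (x ∷ v) (y ∷ w) = cong ((x ∧ y) xor_) (padRight-· m≤n v w)

module _ {G : Graph} where
  open Graph G
  open Orientation

  membership : (Xs : List (Subset order)) → Vertex → Vec Bool (length Xs)
  membership []       u = []
  membership (X ∷ Xs) u = lookup X u ∷ membership Xs u

  arc-invert : ∀ X (D : Orientation G) {u v} → Adjacent u v →
               arc (invert X D) u v ≡ arc D u v xor both-in {G} X u v
  arc-invert X D {u} {v} uv∈E with both-in {G} X u v
  ... | false = sym (xor-identityʳ _)
  ... | true  rewrite oriented D u v uv∈E with arc D u v
  ...   | true  = refl
  ...   | false = refl

  -- An inversion flips the arc on uv exactly when its set contains both ends. Flips add modulo 2,
  -- and their sum over the sequence is the scalar product.
  arc-invertAll : ∀ Xs (D : Orientation G) {u v} → Adjacent u v →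
                  arc (invertAll Xs D) u v ≡ arc D u v xor (membership Xs u · membership Xs v)
  arc-invertAll []       D uv∈E = sym (xor-identityʳ _)
  arc-invertAll (X ∷ Xs) D {u} {v} uv∈E = trans (arc-invertAll Xs (invert X D) uv∈E)
    (trans (cong (_xor (membership Xs u · membership Xs v)) (arc-invert X D uv∈E))
           (xor-assoc (arc D u v) (both-in {G} X u v) (membership Xs u · membership Xs v)))

  Realises : ∀ {n} → (Vertex → Vec Bool n) → (Vertex → Vertex → Bool) → Set
  Realises f π = ∀ u v → u < v → Adjacent u v → f u · f v ≡ π u v

  arc-orient : ∀ s {u v} → u < v → Adjacent u v → arc (orient {G} s) u v ≡ s u v
  arc-orient s {u} {v} u<v uv∈E with adj u v
  ... | true rewrite dec-true (u <? v) u<v = refl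

  -- In the initial orientation all edges increase, so label 1 marks a reversed edge and the target
  -- is the complement of `π`. The padded membership vectors realise `π`.
  reaches⇒realises : ∀ {k n} (π : Vertex → Vertex → Bool) → k ≤ n →
    Reaches (orient {G} λ _ _ → true) (orient λ u v → not (π u v)) k →
    ∃[ f ] Realises {n} f π
  reaches⇒realises π k≤n (Xs , refl , p) =
    (λ u → padRight k≤n false (membership Xs u)) ,
    λ u v u<v uv∈E → trans (padRight-· k≤n (membership Xs u) (membership Xs v))
                           (not-injective (flipped u v u<v uv∈E))
    where
    open ≡-Reasoning
    D = orient {G} λ _ _ → true
    flipped : ∀ u v → u < v → Adjacent u v →
              true xor (membership Xs u · membership Xs v) ≡ not (π u v)
    flipped u v u<v uv∈E = begin
      true xor (membership Xs u · membership Xs v)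
        ≡⟨ cong (_xor (membership Xs u · membership Xs v)) (arc-orient (λ _ _ → true) u<v uv∈E) ⟨
      arc D u v xor (membership Xs u · membership Xs v)
        ≡⟨ arc-invertAll Xs D uv∈E ⟨
      arc (invertAll Xs D) u v
        ≡⟨ p u v ⟩
      arc (orient {G} λ u v → not (π u v)) u v
        ≡⟨ arc-orient (λ u v → not (π u v)) u<v uv∈E ⟩
      not (π u v) ∎

  -- At most n inversions between the two orientations would realise `π`. Hence their distance
  -- exceeds n, and the diameter is at least this distance.
  unrealisable⇒diameter> : ∀ n (π : Vertex → Vertex → Bool) → (∀ f → ¬ Realises {n} f π) →
    ∃[ d ] (IsInversionDiameter G d × suc n ≤ d)
  unrealisable⇒diameter> n π none = bound (distance D E)
    where
    D = orient {G} λ _ _ → true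
    E = orient {G} λ u v → not (π u v)
    bound : ∃ (IsInversionDistance D E) → ∃[ d ] (IsInversionDiameter G d × suc n ≤ d)
    bound (k , isK) with k ≤? n | inversionDiameter G
    ... | yes k≤n | _ with f , real ← reaches⇒realises π k≤n (proj₁ isK) =
      contradiction real (none f)
    ... | no  k≰n | d , isD = d , isD , ≤-trans (≰⇒> k≰n) (proj₂ isD k (D , E , isK))

-- Labelled stacked triangulations

data Trie (A : Set) : ℕ → Set where
  leaf : A → Trie A 0
  node : ∀ {n} → Trie A n → Trie A n → Trie A (suc n)

tabulateᵗ : ∀ {A n} → (Vec Bool n → A) → Trie A n
tabulateᵗ {n = zero}  f = leaf (f [])
tabulateᵗ {n = suc n} f = node (tabulateᵗ λ v → f (false ∷ v)) (tabulateᵗ λ v → f (true ∷ v))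

infixl 9 _!_
_!_ : ∀ {A n} → Trie A n → Vec Bool n → A
leaf x   ! []          = x
node l r ! (false ∷ v) = l ! v
node l r ! (true  ∷ v) = r ! v

tabulateᵗ-! : ∀ {A n} (f : Vec Bool n → A) v → tabulateᵗ f ! v ≡ f v
tabulateᵗ-! f []          = refl
tabulateᵗ-! f (false ∷ v) = tabulateᵗ-! (λ w → f (false ∷ w)) v
tabulateᵗ-! f (true  ∷ v) = tabulateᵗ-! (λ w → f (true ∷ w)) v

LabelledEdge : Set → Set
LabelledEdge A = A × A × Bool

-- node x i j k r s t: in the triangle abc, join a new vertex x to a, b, c by edges
-- labelled i, j, k and fill the triangles abx, acx, bcx by r, s, t.
data Stack (A : Set) : Set where
  empty : Stack A
  node  : A → (i j k : Bool) → (r s t : Stack A) → Stack A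

edges : ∀ {A} → Stack A → (a b c : A) → List (LabelledEdge A)
edges empty                a b c = []
edges (node x i j k r s t) a b c =
  (a , x , i) ∷ (b , x , j) ∷ (c , x , k) ∷ edges r a b x ++ edges s a c x ++ edges t b c x

triangle : ∀ {A} → (a b c : A) → (i j k : Bool) → Stack A → List (LabelledEdge A)
triangle a b c i j k s = (a , b , i) ∷ (a , c , j) ∷ (b , c , k) ∷ edges s a b c

module _ (n : ℕ) where
  Plane Table : Set
  Plane = Trie (Trie Bool n) n
  Table = Trie Plane n

module _ {n : ℕ} where
  withProduct : Vec Bool n → Bool → List (Vec Bool n) → List (Vec Bool n)
  withProduct v i = filter λ w → v · w Bool.≟ i

  none : Table n
  none = tabulateᵗ λ _ → tabulateᵗ λ _ → tabulateᵗ λ _ → false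

  module _ (i j k : Bool) where
    -- The work is staged by corner: filtering and lookups that depend on a alone, or on a and b,
    -- are done once for all remaining corners. Here `xs` already fits a and b.
    fill₃ : Vec Bool n → List (Vec Bool n) → (r s t : Trie Bool n) → Bool
    fill₃ c xs r s t = all (λ x → r ! x ∨ s ! x ∨ t ! x) (withProduct c k xs)

    fill₂ : List (Vec Bool n) → Trie Bool n → (s t : Plane n) → Trie Bool n
    fill₂ xs r s t = tabulateᵗ λ c → fill₃ c xs r (s ! c) (t ! c)

    fill₁ : List (Vec Bool n) → (r s : Plane n) → Table n → Plane n
    fill₁ xs r s t = tabulateᵗ λ b → fill₂ (withProduct b j xs) (r ! b) s (t ! b)

    fill : List (Vec Bool n) → (r s t : Table n) → Table n
    fill xs r s t = tabulateᵗ λ a → fill₁ (withProduct a i xs) (r ! a) (s ! a) t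

    -- Undoes the staging, giving the flat form that the soundness proof uses.
    fill-! : ∀ xs r s t a b c → fill xs r s t ! a ! b ! c ≡
      all (λ x → r ! a ! b ! x ∨ s ! a ! c ! x ∨ t ! b ! c ! x)
          (withProduct c k (withProduct b j (withProduct a i xs)))
    fill-! xs r s t a b c
      rewrite tabulateᵗ-! (λ a → fill₁ (withProduct a i xs) (r ! a) (s ! a) t) a
            | tabulateᵗ-! (λ b → fill₂ (withProduct b j (withProduct a i xs)) (r ! a ! b) (s ! a) (t ! b)) b
            | tabulateᵗ-! (λ c → fill₃ c (withProduct b j (withProduct a i xs))
                                         (r ! a ! b) (s ! a ! c) (t ! b ! c)) c = refl

  -- An entry is true if no vectors for the interior vertices fit these three corners. The
  -- values are stored in tries because Agda shares them, so that each is computed once.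
  impossible : ∀ {A} → Stack A → Table n
  impossible empty                = none
  impossible (node _ i j k r s t) = fill i j k (vectors n) (impossible r) (impossible s) (impossible t)

  Obeys : ∀ {A} → (A → Vec Bool n) → LabelledEdge A → Set
  Obeys f (u , v , i) = f u · f v ≡ i

  -- Induction on the stack. The vector `f x` of the new vertex has the three prescribed products,
  -- so it survives the filters; a true entry then makes it bad in one of the three smaller
  -- triangles, where the induction hypothesis applies.
  impossible-sound : ∀ {A} (f : A → Vec Bool n) s a b c →
    T (impossible s ! f a ! f b ! f c) → ¬ All (Obeys f) (edges s a b c)
  -- The table of an empty triangle is constantly false.
  impossible-sound f empty a b c bad _ = subst T
    (trans (cong (λ p → p ! f b ! f c) (tabulateᵗ-! _ (f a)))
      (trans (cong (_! f c) (tabulateᵗ-! _ (f b))) (tabulateᵗ-! _ (f c)))) bad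
  impossible-sound f (node x i j k r s t) a b c bad (ax ∷ bx ∷ cx ∷ rest)
    with Equivalence.to T-∨ (All.lookup
           (all⁺ _ _ (subst T (fill-! i j k (vectors n) (impossible r) (impossible s) (impossible t)
                                      (f a) (f b) (f c)) bad))
           (∈-filter⁺ _ (∈-filter⁺ _ (∈-filter⁺ _ (∈-vectors (f x)) ax) bx) cx))
  ... | inj₁ bad-r = impossible-sound f r a b x bad-r (++⁻ˡ _ rest)
  ... | inj₂ bad-st with Equivalence.to T-∨ bad-st
  ...   | inj₁ bad-s = impossible-sound f s a c x bad-s (++⁻ˡ _ (++⁻ʳ (edges r a b x) rest))
  ...   | inj₂ bad-t = impossible-sound f t b c x bad-t
                         (++⁻ʳ (edges s a c x) (++⁻ʳ (edges r a b x) rest))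

  allImpossible : (i j k : Bool) → Table n → Bool
  allImpossible i j k t =
    all (λ a → all (λ b → all (λ c → t ! a ! b ! c)
      (withProduct b k (withProduct a j (vectors n)))) (withProduct a i (vectors n))) (vectors n)

  -- The vectors of the outer corners are among the triples examined, so one Boolean evaluation
  -- excludes every `f`.
  triangle-unrealisable : ∀ {A} (a b c : A) i j k s → allImpossible i j k (impossible s) ≡ true →
    ∀ (f : A → Vec Bool n) → ¬ All (Obeys f) (triangle a b c i j k s)
  triangle-unrealisable a b c i j k s bad f (ab ∷ ac ∷ bc ∷ rest) = impossible-sound f s a b c
    (All.lookup (all⁺ _ _ (All.lookup (all⁺ _ _ (All.lookup (all⁺ _ _ (Equivalence.from T-≡ bad))
      (∈-vectors (f a)))) (∈-filter⁺ _ (∈-vectors (f b)) ab)))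
      (∈-filter⁺ _ (∈-filter⁺ _ (∈-vectors (f c)) ac) bc)) rest

-- Graphs given by lists of labelled edges

module LabelledGraph {n : ℕ} (es : List (LabelledEdge (Fin n))) where
  joins : Fin n → Fin n → LabelledEdge (Fin n) → Bool
  joins u v (x , y , _) = does (u ≟ x) ∧ does (v ≟ y)

  label : Fin n → Fin n → Bool
  label u v = any (λ e → joins u v e ∧ proj₂ (proj₂ e)) es

  -- An edge listed with both labels would be read as 1 by the disjunction in `label`; `Consistent`
  -- excludes this. `Ascending` rules out loops and matches list entries with edges whose ends
  -- increase.
  Ascending Consistent : LabelledEdge (Fin n) → Set
  Ascending  (u , v , _) = u < v
  Consistent (u , v , i) = label u v ≡ i

  linked : Fin n → Fin n → Bool
  linked u v = any (joins u v) es

  joins-sound : ∀ u v e → T (joins u v e) → u ≡ proj₁ e × v ≡ proj₁ (proj₂ e)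
  joins-sound u v (x , y , _) p with u ≟ x | v ≟ y
  ... | yes u≡x | yes v≡y = u≡x , v≡y

  joins-complete : ∀ u v i → T (joins u v (u , v , i))
  joins-complete u v i rewrite dec-true (u ≟ u) refl | dec-true (v ≟ v) refl = _

  linked⇒∈ : ∀ u v → T (linked u v) → ∃[ i ] ((u , v , i) ∈ es)
  linked⇒∈ u v p = go (any⁻ (joins u v) es p)
    where
    go : ∀ {fs} → Any (T ∘ joins u v) fs → ∃[ i ] ((u , v , i) ∈ fs)
    go (here {x = x , y , i} q) with refl , refl ← joins-sound u v (x , y , i) q = i , here refl
    go (there q) with i , r ← go q = i , there r

  ∈⇒linked : ∀ {u v i} → (u , v , i) ∈ es → T (linked u v)
  ∈⇒linked {u} {v} {i} p = any⁺ (joins u v) (Any.map (λ { refl → joins-complete u v i }) p)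

  module _ (ascending : All Ascending es) where
    linked⇒< : ∀ u v → T (linked u v) → u < v
    linked⇒< u v p with i , e∈es ← linked⇒∈ u v p = All.lookup ascending e∈es

    graph : Graph
    graph = record
      { order     = n
      ; adj       = λ u v → linked u v ∨ linked v u
      ; symmetric = λ u v → ∨-comm (linked u v) (linked v u)
      ; loopless  = loopless
      }
      where
      loopless : ∀ v → linked v v ∨ linked v v ≡ false
      loopless v with linked v v in eq
      ... | false = refl
      ... | true  = contradiction (linked⇒< v v (subst T (sym eq) _)) (<-irrefl {x = v} refl)

    open Graph graph using (Adjacent)

    adjacent⇒∈ : ∀ {u v} → u < v → Adjacent u v → ∃[ i ] ((u , v , i) ∈ es)
    adjacent⇒∈ {u} {v} u<v p with Equivalence.to T-∨ p
    ... | inj₁ uv = linked⇒∈ u v uv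
    ... | inj₂ vu = contradiction (linked⇒< v u vu) (<-asym u<v)

    ∈⇒adjacent : ∀ {u v i} → (u , v , i) ∈ es → Adjacent u v
    ∈⇒adjacent p = Equivalence.from T-∨ (inj₁ (∈⇒linked p))

    realises⇒obeys : All Consistent es → ∀ {m} (f : Fin n → Vec Bool m) →
                     Realises {graph} f label → All (Obeys f) es
    realises⇒obeys consistent f real = All.tabulate λ {(u , v , i)} e∈es →
      trans (real u v (All.lookup ascending e∈es) (∈⇒adjacent e∈es)) (All.lookup consistent e∈es)

-- Straight-line drawings

fromℤ-+ : ∀ a b → fromℤ (a ℤ.+ b) ≡ fromℤ a ℚ.+ fromℤ b
fromℤ-+ a b = ℚ.toℚᵘ-injective (ℚᵘ.≃-trans
  (ℚᵘ.*≡* (solve 2 (λ a b → (a :+ b) :* con (+ 1) := (a :* con (+ 1) :+ b :* con (+ 1)) :* con (+ 1)) refl a b))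
  (ℚᵘ.≃-sym (ℚ.toℚᵘ-homo-+ (fromℤ a) (fromℤ b))))
  where open ℤSolver.+-*-Solver

fromℤ-* : ∀ a b → fromℤ (a ℤ.* b) ≡ fromℤ a ℚ.* fromℤ b
fromℤ-* a b = ℚ.toℚᵘ-injective (ℚᵘ.≃-sym (ℚ.toℚᵘ-homo-* (fromℤ a) (fromℤ b)))

fromℤ-neg : ∀ a → fromℤ (ℤ.- a) ≡ ℚ.- fromℤ a
fromℤ-neg a = ℚ.toℚᵘ-injective (ℚᵘ.≃-sym (ℚ.toℚᵘ-homo‿- (fromℤ a)))

fromℤ-- : ∀ a b → fromℤ (a ℤ.- b) ≡ fromℤ a ℚ.- fromℤ b
fromℤ-- a b = trans (fromℤ-+ a (ℤ.- b)) (cong (fromℤ a ℚ.+_) (fromℤ-neg b))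

fromℤ-injective : ∀ {a b} → fromℤ a ≡ fromℤ b → a ≡ b
fromℤ-injective = cong ℚ.↥_

Lattice : Set
Lattice = ℤ × ℤ

point : Lattice → Point
point (x , y) = fromℤ x , fromℤ y

point-injective : ∀ {p q} → point p ≡ point q → p ≡ q
point-injective eq = cong₂ _,_ (fromℤ-injective (cong proj₁ eq)) (fromℤ-injective (cong proj₂ eq))

-- Twice the signed area of the triangle abc: positive when c lies to the left of the line from a to
-- b. The integer version is the one evaluated in the checks.
detℤ : Lattice → Lattice → Lattice → ℤ
detℤ (ax , ay) (bx , by) (cx , cy) =
  (bx ℤ.- ax) ℤ.* (cy ℤ.- ay) ℤ.- (by ℤ.- ay) ℤ.* (cx ℤ.- ax)

det : Point → Point → Point → ℚ
det (ax , ay) (bx , by) (cx , cy) =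
  (bx ℚ.- ax) ℚ.* (cy ℚ.- ay) ℚ.- (by ℚ.- ay) ℚ.* (cx ℚ.- ax)

fromℤ-det : ∀ a b c → fromℤ (detℤ a b c) ≡ det (point a) (point b) (point c)
fromℤ-det (ax , ay) (bx , by) (cx , cy) =
  trans (fromℤ-- ((bx ℤ.- ax) ℤ.* (cy ℤ.- ay)) ((by ℤ.- ay) ℤ.* (cx ℤ.- ax)))
    (cong₂ ℚ._-_ (product bx ax cy ay) (product by ay cx ax))
  where
  product : ∀ p q r s → fromℤ ((p ℤ.- q) ℤ.* (r ℤ.- s)) ≡ (fromℤ p ℚ.- fromℤ q) ℚ.* (fromℤ r ℚ.- fromℤ s)
  product p q r s = trans (fromℤ-* (p ℤ.- q) (r ℤ.- s)) (cong₂ ℚ._*_ (fromℤ-- p q) (fromℤ-- r s))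

0≤1-t : ∀ {t} → t ℚ.≤ 1ℚ → 0ℚ ℚ.≤ 1ℚ ℚ.- t
0≤1-t {t} t≤1 = subst (ℚ._≤ 1ℚ ℚ.- t) (ℚ.+-inverseʳ t) (ℚ.+-monoˡ-≤ (ℚ.- t) t≤1)

module _ where
  open ℚSolver.+-*-Solver

  det-line : ∀ a b {p} → OnSegment a b p → det a b p ≡ 0ℚ
  det-line (ax , ay) (bx , by) (t , _ , _ , refl , refl) =
    solve 5 (λ ax ay bx by t →
      (bx :- ax) :* (((con 1ℚ :- t) :* ay :+ t :* by) :- ay) :-
      (by :- ay) :* (((con 1ℚ :- t) :* ax :+ t :* bx) :- ax) := con 0ℚ) refl ax ay bx by t

  det-affine : ∀ a b c d {p} ((t , _) : OnSegment c d p) →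
               det a b p ≡ (1ℚ ℚ.- t) ℚ.* det a b c ℚ.+ t ℚ.* det a b d
  det-affine (ax , ay) (bx , by) (cx , cy) (dx , dy) (t , _ , _ , refl , refl) =
    solve 9 (λ ax ay bx by cx cy dx dy t →
      (bx :- ax) :* (((con 1ℚ :- t) :* cy :+ t :* dy) :- ay) :-
      (by :- ay) :* (((con 1ℚ :- t) :* cx :+ t :* dx) :- ax) :=
      (con 1ℚ :- t) :* ((bx :- ax) :* (cy :- ay) :- (by :- ay) :* (cx :- ax)) :+
      t :* ((bx :- ax) :* (dy :- ay) :- (by :- ay) :* (dx :- ax))) refl ax ay bx by cx cy dx dy t

  OnSegment-sym : ∀ {a b p} → OnSegment a b p → OnSegment b a p
  OnSegment-sym {ax , ay} {bx , by} (t , 0≤t , t≤1 , refl , refl) =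
    1ℚ ℚ.- t , 0≤1-t t≤1 ,
    ℚ.+-monoʳ-≤ 1ℚ (ℚ.neg-antimono-≤ 0≤t) ,
    swap t ax bx , swap t ay by
    where
    swap : ∀ t x y → (1ℚ ℚ.- t) ℚ.* x ℚ.+ t ℚ.* y ≡ (1ℚ ℚ.- (1ℚ ℚ.- t)) ℚ.* y ℚ.+ (1ℚ ℚ.- t) ℚ.* x
    swap = solve 3 (λ t x y → (con 1ℚ :- t) :* x :+ t :* y :=
      (con 1ℚ :- (con 1ℚ :- t)) :* y :+ (con 1ℚ :- t) :* x) refl

  segment-start : ∀ x y → (1ℚ ℚ.- 0ℚ) ℚ.* x ℚ.+ 0ℚ ℚ.* y ≡ x
  segment-start = solve 2 (λ x y → (con 1ℚ :- con 0ℚ) :* x :+ con 0ℚ :* y := x) refl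

start-onSegment : ∀ a b → OnSegment a b a
start-onSegment (ax , ay) (bx , by) =
  0ℚ , ℚ.≤-refl , ℚ.nonNegative⁻¹ 1ℚ , sym (segment-start ax bx) , sym (segment-start ay by)

end-onSegment : ∀ a b → OnSegment a b b
end-onSegment a b = OnSegment-sym {b} {a} (start-onSegment b a)

convex-positive : ∀ {t α β} → 0ℚ ℚ.≤ t → t ℚ.≤ 1ℚ → 0ℚ ℚ.< α → 0ℚ ℚ.< β →
                  0ℚ ℚ.< (1ℚ ℚ.- t) ℚ.* α ℚ.+ t ℚ.* β
convex-positive {t} {α} {β} 0≤t t≤1 0<α 0<β with t ℚ.≟ 0ℚ
-- At t = 0 positivity comes from α; otherwise t β is positive and the other term nonnegative.
... | yes refl = subst (0ℚ ℚ.<_) (sym (segment-start α β)) 0<α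
... | no t≢0 = ℚ.positive⁻¹ _ {{ℚ.nonNeg+pos⇒pos ((1ℚ ℚ.- t) ℚ.* α)
    {{ℚ.nonNeg*nonNeg⇒nonNeg (1ℚ ℚ.- t) {{nonNegative (0≤1-t t≤1)}} α {{nonNegative (ℚ.<⇒≤ 0<α)}}}}
    (t ℚ.* β) {{ℚ.pos*pos⇒pos t
      {{ℚ.nonNeg∧nonZero⇒pos t {{nonNegative 0≤t}} {{ℚ.≢-nonZero t≢0}}}} β {{positive 0<β}}}}}}

Left : (a b c d : Lattice) → Set
Left a b c d = 0ℤ ℤ.< detℤ a b c × 0ℤ ℤ.< detℤ a b d

-- The determinant with a and b vanishes on ab, but is a convex combination of two positive values
-- along cd.
left-disjoint : ∀ {a b c d} → Left a b c d → ∀ {p} →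
  OnSegment (point a) (point b) p → ¬ OnSegment (point c) (point d) p
left-disjoint {a} {b} {c} {d} (0<c , 0<d) p∈ab p∈cd@(t , 0≤t , t≤1 , _) =
  ℚ.<-irrefl (trans (sym (det-line (point a) (point b) p∈ab))
                    (det-affine (point a) (point b) (point c) (point d) p∈cd))
             (convex-positive 0≤t t≤1 (lift c 0<c) (lift d 0<d))
  where
  lift : ∀ q → 0ℤ ℤ.< detℤ a b q → 0ℚ ℚ.< det (point a) (point b) (point q)
  lift q 0<q = subst (0ℚ ℚ.<_) (fromℤ-det a b q)
    (ℚ.*<* (subst₂ ℤ._<_ refl (sym (ℤ.*-identityʳ _)) 0<q))

*-zero-cancelʳ : ∀ {t β} → β ≢ 0ℚ → t ℚ.* β ≡ 0ℚ → t ≡ 0ℚ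
*-zero-cancelʳ {t} {β} β≢0 tβ≡0 = begin
  t                        ≡⟨ ℚ.*-identityʳ t ⟨
  t ℚ.* 1ℚ                 ≡⟨ cong (t ℚ.*_) (ℚ.*-inverseʳ β) ⟨
  t ℚ.* (β ℚ.* (ℚ.1/ β))   ≡⟨ ℚ.*-assoc t β (ℚ.1/ β) ⟨
  t ℚ.* β ℚ.* (ℚ.1/ β)     ≡⟨ cong (ℚ._* (ℚ.1/ β)) tβ≡0 ⟩
  0ℚ ℚ.* (ℚ.1/ β)          ≡⟨ ℚ.*-zeroˡ (ℚ.1/ β) ⟩
  0ℚ                       ∎
  where
  open ≡-Reasoning
  instance β-nonZero = ℚ.≢-nonZero β≢0

-- As c is on the line ab, the determinant at parameter t of cd is t times its value at d, so it
-- vanishes only at t = 0.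
meets-at-start : ∀ a b c d {p} → OnSegment a b c → det a b d ≢ 0ℚ →
                 OnSegment a b p → OnSegment c d p → p ≡ c
meets-at-start a b c d {p} c∈ab d∉ab p∈ab p∈cd@(t , _ , _ , x≡ , y≡) =
  cong₂ _,_ (trans x≡ (at-zero (proj₁ c) (proj₁ d))) (trans y≡ (at-zero (proj₂ c) (proj₂ d)))
  where
  open ≡-Reasoning
  t≡0 : t ≡ 0ℚ
  t≡0 = *-zero-cancelʳ d∉ab (begin
    t ℚ.* det a b d                                       ≡⟨ ℚ.+-identityˡ _ ⟨
    0ℚ ℚ.+ t ℚ.* det a b d                                ≡⟨ cong (ℚ._+ t ℚ.* det a b d) (ℚ.*-zeroʳ (1ℚ ℚ.- t)) ⟨
    (1ℚ ℚ.- t) ℚ.* 0ℚ ℚ.+ t ℚ.* det a b d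
      ≡⟨ cong (λ z → (1ℚ ℚ.- t) ℚ.* z ℚ.+ t ℚ.* det a b d) (det-line a b c∈ab) ⟨
    (1ℚ ℚ.- t) ℚ.* det a b c ℚ.+ t ℚ.* det a b d          ≡⟨ det-affine a b c d p∈cd ⟨
    det a b p                                             ≡⟨ det-line a b p∈ab ⟩
    0ℚ                                                    ∎)
  at-zero : ∀ x y → (1ℚ ℚ.- t) ℚ.* x ℚ.+ t ℚ.* y ≡ x
  at-zero x y = trans (cong (λ t → (1ℚ ℚ.- t) ℚ.* x ℚ.+ t ℚ.* y) t≡0) (segment-start x y)

module StraightLine {G : Graph} (place : Fin (Graph.order G) → Lattice) where
  open Graph G
  open Edge

  -- The disjuncts with an equation treat two edges with a common end.
  Uncrossed : (u v w x : Vertex) → Set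
  Uncrossed u v w x =
    Left (place u) (place v) (place w) (place x) ⊎ Left (place v) (place u) (place w) (place x) ⊎
    Left (place w) (place x) (place u) (place v) ⊎ Left (place x) (place w) (place u) (place v) ⊎
    (w ≡ u ⊎ w ≡ v) × detℤ (place u) (place v) (place x) ≢ 0ℤ ⊎
    (x ≡ u ⊎ x ≡ v) × detℤ (place u) (place v) (place w) ≢ 0ℤ

  left? : ∀ a b c d → Dec (Left a b c d)
  left? a b c d = (0ℤ ℤ.<? detℤ a b c) ×-dec (0ℤ ℤ.<? detℤ a b d)

  uncrossed? : ∀ u v w x → Dec (Uncrossed u v w x)
  uncrossed? u v w x =
    left? (place u) (place v) (place w) (place x) ⊎-dec left? (place v) (place u) (place w) (place x) ⊎-dec
    left? (place w) (place x) (place u) (place v) ⊎-dec left? (place x) (place w) (place u) (place v) ⊎-dec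
    (((w ≟ u) ⊎-dec (w ≟ v)) ×-dec ¬? (detℤ (place u) (place v) (place x) ℤ.≟ 0ℤ)) ⊎-dec
    (((x ≟ u) ⊎-dec (x ≟ v)) ×-dec ¬? (detℤ (place u) (place v) (place w) ℤ.≟ 0ℤ))

  at : Vertex → Point
  at v = point (place v)

  On : (u v : Vertex) → Point → Set
  On u v = OnSegment (at u) (at v)

  meets-at-end : ∀ u v w x {p} → (w ≡ u ⊎ w ≡ v) → detℤ (place u) (place v) (place x) ≢ 0ℤ →
                 On u v p → On w x p → p ≡ at u ⊎ p ≡ at v
  meets-at-end u v w x {p} end x∉uv p∈uv p∈wx =
    Sum.map (λ { refl → p≡w }) (λ { refl → p≡w }) end
    where
    p≡w : p ≡ at w
    p≡w = meets-at-start (at u) (at v) (at w) (at x)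
      (Sum.[ (λ { refl → start-onSegment (at u) (at v) }) , (λ { refl → end-onSegment (at u) (at v) }) ] end)
      (λ det≡0 → x∉uv (fromℤ-injective (trans (fromℤ-det (place u) (place v) (place x)) det≡0)))
      p∈uv p∈wx

  -- In the first four cases one segment lies strictly on one side of the other, so they are
  -- disjoint. In the last two they can meet only in the common end.
  uncrossed-meet : ∀ u v w x → Uncrossed u v w x → ∀ {p} →
                   On u v p → On w x p → p ≡ at u ⊎ p ≡ at v
  uncrossed-meet u v w x (inj₁ l) p∈uv p∈wx =
    contradiction p∈wx (left-disjoint {place u} {place v} {place w} {place x} l p∈uv)
  uncrossed-meet u v w x (inj₂ (inj₁ l)) p∈uv p∈wx = contradiction p∈wx
    (left-disjoint {place v} {place u} {place w} {place x} l (OnSegment-sym {at u} {at v} p∈uv))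
  uncrossed-meet u v w x (inj₂ (inj₂ (inj₁ l))) p∈uv p∈wx =
    contradiction p∈uv (left-disjoint {place w} {place x} {place u} {place v} l p∈wx)
  uncrossed-meet u v w x (inj₂ (inj₂ (inj₂ (inj₁ l)))) p∈uv p∈wx = contradiction p∈uv
    (left-disjoint {place x} {place w} {place u} {place v} l (OnSegment-sym {at w} {at x} p∈wx))
  uncrossed-meet u v w x (inj₂ (inj₂ (inj₂ (inj₂ (inj₁ (end , x∉uv)))))) p∈uv p∈wx =
    meets-at-end u v w x end x∉uv p∈uv p∈wx
  uncrossed-meet u v w x (inj₂ (inj₂ (inj₂ (inj₂ (inj₂ (end , w∉uv)))))) p∈uv p∈wx =
    meets-at-end u v x w end w∉uv p∈uv (OnSegment-sym {at w} {at x} p∈wx)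

  straight : ∀ {u v} → at u ≢ at v → PolygonalArc (at u) (at v)
  straight {u} {v} u≢v = record
    { bends         = 0
    ; corner        = λ { zero → at u ; (suc zero) → at v }
    ; start         = refl
    ; end           = refl
    ; nondegenerate = λ { zero → u≢v }
    ; simple        = λ { zero zero _ () }
    }

  -- Edges avoid vertices because they avoid edges: a vertex inside e is an end of some edge f,
  -- which differs from e, and e and f meet only at ends of e.
  straightLineDrawing :
    (∀ u v → place u ≡ place v → u ≡ v) →
    (∀ v → ∃[ e ] (v ≡ left e ⊎ v ≡ right e)) →
    (∀ (e f : Edge G) → ends e ≢ ends f → Uncrossed (left e) (right e) (left f) (right f)) →
    PlaneDrawing G
  straightLineDrawing inj incident uncrossed = record
    { place           = at
    ; injective       = at-injective
    ; curve           = λ e → straight {left e} {right e} (distinct e)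
    ; avoids-vertices = avoids-vertices
    ; avoids-edges    = λ { e f e≢f p ((zero , p∈e) , p≢u , p≢v) (zero , p∈f) → Sum.[ p≢u , p≢v ]
        (uncrossed-meet (left e) (right e) (left f) (right f) (uncrossed e f e≢f) p∈e p∈f) }
    }
    where
    at-injective : ∀ u v → at u ≡ at v → u ≡ v
    at-injective u v eq = inj u v (point-injective eq)

    distinct : ∀ e → at (left e) ≢ at (right e)
    distinct e eq = <-irrefl (at-injective (left e) (right e) eq) (left<right e)

    avoids-vertices : ∀ e w → ¬ PolygonalArc.Interior (straight {left e} {right e} (distinct e)) (at w)
    avoids-vertices e w ((zero , w∈e) , w≢u , w≢v) with incident w
    ... | f , w∈f = Sum.[ w≢u , w≢v ]
      (uncrossed-meet (left e) (right e) (left f) (right f) (uncrossed e f e≢f) w∈e (on w∈f))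
      where
      e≢f : ends e ≢ ends f
      e≢f refl = Sum.[ (λ { refl → w≢u refl }) , (λ { refl → w≢v refl }) ] w∈f
      on : w ≡ left f ⊎ w ≡ right f → On (left f) (right f) (at w)
      on (inj₁ refl) = start-onSegment (at (left f)) (at (right f))
      on (inj₂ refl) = end-onSegment (at (left f)) (at (right f))

-- A labelling that cannot be realised over F₂⁵

module _ {n : ℕ} (es : List (LabelledEdge (Fin n))) (ascending : All (LabelledGraph.Ascending es) es) where
  open LabelledGraph es
  open Edge

  private G = graph ascending

  -- Reduces planarity to finite checks over the edge list. The list is paired with itself, hence
  -- the alternative that both entries are the same edge.
  planarFromLattice : (place : Fin n → Lattice) → let open StraightLine {G} place in
    (∀ u v → place u ≡ place v → u ≡ v) →
    (∀ v → Any (λ (u , w , _) → v ≡ u ⊎ v ≡ w) es) →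
    All (λ (u , v , _) → All (λ (w , x , _) → (u ≡ w × v ≡ x) ⊎ Uncrossed u v w x) es) es →
    Planar G
  planarFromLattice place injective incident uncrossed =
    straightLineDrawing injective incident-edge uncrossed-edges
    where
    open StraightLine {G} place
    incident-edge : ∀ v → ∃[ e ] (v ≡ left e ⊎ v ≡ right e)
    incident-edge v with (u , w , i) , uw∈es , v∈uw ← find (incident v) = record
      { left = u ; right = w
      ; left<right = All.lookup ascending uw∈es ; adjacent = ∈⇒adjacent ascending uw∈es } , v∈uw

    uncrossed-edges : ∀ (e f : Edge G) → ends e ≢ ends f →
                      Uncrossed (left e) (right e) (left f) (right f)
    uncrossed-edges e f e≢f
      with i , e∈es ← adjacent⇒∈ ascending (left<right e) (adjacent e)
         | j , f∈es ← adjacent⇒∈ ascending (left<right f) (adjacent f)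
      with All.lookup (All.lookup uncrossed e∈es) f∈es
    ... | inj₁ (u≡w , v≡x) = contradiction (cong₂ _,_ u≡w v≡x) e≢f
    ... | inj₂ unc = unc

  disobeyed⇒diameter> : ∀ m → All Consistent es → (∀ f → ¬ All (Obeys {m} f) es) →
                        ∃[ d ] (IsInversionDiameter G d × suc m ≤ d)
  disobeyed⇒diameter> m consistent none = unrealisable⇒diameter> m label λ f real →
    none f (realises⇒obeys ascending consistent f real)

-- Turns a decision procedure into a proof: with `refl` as argument, the type checker evaluates the
-- decision.
holds : {A : Set} (a? : Dec A) → does a? ≡ true → A
holds (yes a) _ = a

pattern O = false
pattern I = true

-- Found by a computer search over stacked triangulations.
witness : Stack (Fin 31)
witness =
  node (# 3) I O O
    (node (# 4) I O I
       empty
       (node (# 5) I O O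
          (node (# 6) O I O empty empty empty)
          (node (# 7) O I O empty empty empty)
          (node (# 8) I O O
             empty empty
             (node (# 9) O O O
                (node (# 10) O O I
                   (node (# 11) O O O
                      (node (# 12) O I O empty empty empty)
                      (node (# 13) I O O empty empty empty)
                      (node (# 14) O I O
                         empty
                         (node (# 15) I I O empty empty empty)
                         empty))
                   (node (# 16) O I O empty empty empty)
                   (node (# 17) O O I empty empty empty))
                (node (# 18) O I O
                   empty
                   (node (# 19) I I I empty empty empty)
                   empty)
                empty)))
       empty)
    empty
    (node (# 20) O O O
       empty
       (node (# 21) O O I
          (node (# 22) O O O
             (node (# 23) I O O empty empty empty)
             (node (# 24) O I O
                empty
                (node (# 25) I I O empty empty empty)
                empty)
             (node (# 26) I O O empty empty empty))
          (node (# 27) O O I empty empty empty)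
          (node (# 28) O I O empty empty empty))
       (node (# 29) I O O
          empty empty
          (node (# 30) I I I empty empty empty)))

witnessEdges : List (LabelledEdge (Fin 31))
witnessEdges = triangle (# 0) (# 1) (# 2) O I O witness

open LabelledGraph witnessEdges

-- The inner vertices are numbered in preorder, so each is larger than the three corners it is
-- joined to.
ascending : All Ascending witnessEdges
ascending = holds (All.all? (λ (u , v , _) → u <? v) witnessEdges) refl

consistent : All Consistent witnessEdges
consistent = holds (All.all? (λ (u , v , i) → label u v Bool.≟ i) witnessEdges) refl

-- The finite search behind the lower bound, run by evaluation; over F₂⁵ each table has 32³ entries.
witness-impossible : allImpossible O I O (impossible {5} witness) ≡ true
witness-impossible = refl

-- A drawing on a small grid, with all vertices in the triangle of the first three. Its correctness
-- rests on the checks of `place-injective` and `uncrossed`.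
place : Fin 31 → Lattice
place = lookup (Vec.map (Product.map +_ +_)
  ((0 , 28) ∷ (28 , 0) ∷ (0 , 0) ∷ (1 , 11) ∷ (24 , 3) ∷ (3 , 23) ∷ (1 , 22) ∷ (10 , 17) ∷
   (3 , 11) ∷ (5 , 13) ∷ (8 , 13) ∷ (14 , 11) ∷ (14 , 12) ∷ (15 , 9) ∷ (8 , 15) ∷ (7 , 18) ∷
   (12 , 10) ∷ (5 , 17) ∷ (8 , 10) ∷ (10 , 10) ∷ (6 , 1) ∷ (8 , 4) ∷ (10 , 6) ∷ (12 , 6) ∷
   (12 , 4) ∷ (18 , 3) ∷ (5 , 8) ∷ (13 , 2) ∷ (5 , 5) ∷ (2 , 2) ∷ (3 , 5) ∷ []))

place-injective : ∀ u v → place u ≡ place v → u ≡ v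
place-injective = holds (Fin.all? λ u → Fin.all? λ v →
  ≡-dec ℤ._≟_ ℤ._≟_ (place u) (place v) →-dec (u ≟ v)) refl

incident : ∀ v → Any (λ (u , w , _) → v ≡ u ⊎ v ≡ w) witnessEdges
incident = holds (Fin.all? λ v → Any.any? (λ (u , w , _) → (v ≟ u) ⊎-dec (v ≟ w)) witnessEdges) refl

open StraightLine {graph ascending} place

uncrossed : All (λ (u , v , _) →
  All (λ (w , x , _) → (u ≡ w × v ≡ x) ⊎ Uncrossed u v w x) witnessEdges) witnessEdges
uncrossed = holds (All.all? (λ (u , v , _) → All.all? (λ (w , x , _) →
  ((u ≟ w) ×-dec (v ≟ x)) ⊎-dec uncrossed? u v w x) witnessEdges) witnessEdges) refl

mainTheorem4 : ∃[ G ] (Planar G × ∃[ d ] (IsInversionDiameter G d × d ≥ 6))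
mainTheorem4 = graph ascending ,
  planarFromLattice witnessEdges ascending place place-injective incident uncrossed ,
  -- Dimension 5 is excluded, so the bound obtained is `suc 5`, that is 6.
  disobeyed⇒diameter> witnessEdges ascending 5 consistent
    (triangle-unrealisable (# 0) (# 1) (# 2) O I O witness witness-impossible)
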